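{- Let $L$ be a lattice that is isomorphic to a sublattice of a free lattice $FL(S)$ for some set $S$ (of arbitrary cardinality). If $L$ is locally finite, then $L$ is countable.
   Context: A lattice is a poset in which every nonempty finite subset has a greatest lower bound and a least upper bound; for two elements these are written $a \wedge b$ and $a \vee b$. Lattices are not required to have a least or greatest element. A sublattice of a lattice $K$ is a subset closed under the binary operations $\vee$ and $\wedge$ of $K$, with the induced order. A lattice homomorphism is a map preserving binary joins and binary meets (it need not preserve any bounds); two lattices are isomorphic if there are mutually inverse bijective lattice homomorphisms between them. For a set $S$, the free lattice $FL(S)$ is the lattice containing $S$ (unique up to isomorphism) such that for every lattice $K$ and every function $f : S \to K$ there is a unique lattice homomorphism $g : FL(S) \to K$ with $g(s) = f(s)$ for all $s \in S$. A poset $P$ is locally finite if for all $a, b \in P$ with $a \leq b$, the interval $[a,b] = \{c \in P : a \leq c \leq b\}$ is finite. "Countable" means finite or countably infinite. The ambient set theory is ZFC. -}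

module Defs where

open import Algebra.Lattice.Bundles using (RawLattice)
open import Algebra.Lattice.Morphism.Structures using (module LatticeMorphisms)
open import Axiom.ExcludedMiddle using (ExcludedMiddle)
open import Data.Fin using (Fin)
open import Data.Nat using (ℕ)
open import Data.Product using (Σ; ∃; ∃!; _×_; _,_; proj₁)
open import Data.Sum using (_⊎_)
open import Function.Bundles using (Func; Injection; Inverse)
open import Function.Definitions using (Inverseᵇ)
open import Level using (Level; _⊔_; suc; Setω)
open import Relation.Binary.Bundles using (Setoid; Poset)
open import Relation.Binary.Definitions using (_Respects_)
open import Relation.Binary.Lattice using (Lattice)
import Relation.Binary.Construct.On as On
import Relation.Binary.PropositionalEquality as ≡
open import Relation.Unary using (Pred)

-- The ambient theory is classical (ZFC), which Agda has to assume explicitly.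
-- Dec P carries an element of P when P holds, so this also provides the axiom
-- of choice: from ∀ x → ¬ ¬ ∃ (R x) one obtains a function x ↦ y with R x y.

Classical : Setω
Classical = ∀ ℓ → ExcludedMiddle ℓ

-- Sets are rendered as setoids, so finiteness and countability count
-- elements up to _≈_.

Finite : ∀ {a ℓ} → Setoid a ℓ → Set (a ⊔ ℓ)
Finite X = ∃ λ n → Inverse X (≡.setoid (Fin n))

CountablyInfinite : ∀ {a ℓ} → Setoid a ℓ → Set (a ⊔ ℓ)
CountablyInfinite X = Inverse X (≡.setoid ℕ)

Countable : ∀ {a ℓ} → Setoid a ℓ → Set (a ⊔ ℓ)
Countable X = Finite X ⊎ CountablyInfinite X

module _ {c ℓ₁ ℓ₂} (P : Poset c ℓ₁ ℓ₂) where
  open Poset P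

  Interval : Carrier → Carrier → Setoid (c ⊔ ℓ₂) ℓ₁
  Interval a b = On.setoid Eq.setoid (proj₁ {B = λ x → a ≤ x × x ≤ b})

  LocallyFinite : Set (c ⊔ ℓ₁ ⊔ ℓ₂)
  LocallyFinite = ∀ a b → a ≤ b → Finite (Interval a b)

rawLattice : ∀ {c ℓ₁ ℓ₂} → Lattice c ℓ₁ ℓ₂ → RawLattice c ℓ₁
rawLattice K = record { _≈_ = _≈_ ; _∧_ = _∧_ ; _∨_ = _∨_ }
  where open Lattice K

IsLatticeHom : ∀ {c ℓ₁ ℓ₂ c′ ℓ₁′ ℓ₂′} (K : Lattice c ℓ₁ ℓ₂) (M : Lattice c′ ℓ₁′ ℓ₂′) →
               (Lattice.Carrier K → Lattice.Carrier M) → Set (c ⊔ ℓ₁ ⊔ ℓ₁′)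
IsLatticeHom K M =
  LatticeMorphisms.IsLatticeHomomorphism (rawLattice K) (rawLattice M)

infix 4 _≅_

record _≅_ {c ℓ₁ ℓ₂ c′ ℓ₁′ ℓ₂′} (K : Lattice c ℓ₁ ℓ₂) (M : Lattice c′ ℓ₁′ ℓ₂′)
           : Set (c ⊔ ℓ₁ ⊔ c′ ⊔ ℓ₁′) where
  private
    module K = Lattice K
    module M = Lattice M
  field
    to       : K.Carrier → M.Carrier
    from     : M.Carrier → K.Carrier
    to-hom   : IsLatticeHom K M to
    from-hom : IsLatticeHom M K from
    inverse  : Inverseᵇ K._≈_ M._≈_ to from

record Sublattice {c ℓ₁ ℓ₂} (K : Lattice c ℓ₁ ℓ₂) (p : Level)
                  : Set (c ⊔ ℓ₁ ⊔ suc p) where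
  open Lattice K
  field
    Member   : Pred Carrier p
    respects : Member Respects _≈_
    ∨-closed : ∀ {x y} → Member x → Member y → Member (x ∨ y)
    ∧-closed : ∀ {x y} → Member x → Member y → Member (x ∧ y)

  lattice : Lattice (c ⊔ p) ℓ₁ ℓ₂
  lattice = record
    { Carrier   = Σ Carrier Member
    ; _≈_       = λ x y → proj₁ x ≈ proj₁ y
    ; _≤_       = λ x y → proj₁ x ≤ proj₁ y
    ; _∨_       = λ (x , x∈) (y , y∈) → x ∨ y , ∨-closed x∈ y∈
    ; _∧_       = λ (x , x∈) (y , y∈) → x ∧ y , ∧-closed x∈ y∈
    ; isLattice = record
      { isPartialOrder = On.isPartialOrder proj₁ isPartialOrder
      ; supremum       = λ (x , _) (y , _) →
          x≤x∨y x y , y≤x∨y x y , λ _ → ∨-least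
      ; infimum        = λ (x , _) (y , _) →
          x∧y≤x x y , x∧y≤y x y , λ _ → ∧-greatest
      }
    }

-- The universal property ranges over lattices of every universe level, so
-- the record lives in Setω.

record FreeLattice {s r} (S : Setoid s r) (c ℓ₁ ℓ₂ : Level) : Setω where
  field
    lattice : Lattice c ℓ₁ ℓ₂
  open Lattice lattice using (Carrier; setoid)
  field
    inclusion : Injection S setoid
  open Injection inclusion using () renaming (to to ι)
  field
    universal : ∀ {c′ ℓ₁′ ℓ₂′} (K : Lattice c′ ℓ₁′ ℓ₂′) →
      let module K = Lattice K in
      (f : Func S K.setoid) →
      ∃! (λ (g h : Carrier → K.Carrier) → ∀ x → g x K.≈ h x)
         (λ g → IsLatticeHom lattice K g × (∀ x → g (ι x) K.≈ Func.to f x))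

{-# OPTIONS --safe #-}

-- Whitman's solution of the word problem embeds FL(S) into the lattice of terms,
-- ordered by cut-free derivability, so let L be a lattice of terms. Write
-- t⟪σ⟫ for the instance of a term t at a tuple σ of generators. If
-- w₀, w₁, w₂, … are instances in L of the same t at pairwise disjoint injective
-- tuples, the elements (w₀ ∨ w₁) ∧ (w₀ ∨ wⱼ) lie in the finite interval
-- [w₀, w₀ ∨ w₁], so two of them coincide and (w₀ ∨ w₁) ∧ (w₀ ∨ wⱼ) ≤ w₀ ∨ wₖ
-- with j ≠ k. By Whitman's condition, and since generators may be renamed, this
-- forces t⟪α⟫ ≤ t⟪β⟫ for all α and β, so t has a single instance. If no such
-- sequence can be chosen greedily, there is a finite set F of generators such
-- that every tuple giving an instance in L repeats an entry or has one in F.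
-- Either way a variable of t can be eliminated, so the instances of t in L are
-- countable by induction on the number of variables; and there are only
-- countably many shapes t.

module Submission where

open import Defs
open import Relation.Binary.Bundles using (Setoid)
open import Relation.Binary.Lattice using (Lattice)

open import Algebra.Lattice.Morphism.Structures using (module LatticeMorphisms)
open import Data.Fin.Base as Fin using (Fin; toℕ; fromℕ<; punchIn; punchOut; _↑ˡ_; _↑ʳ_)
open import Data.Fin.Properties as Finₚ
  using (toℕ-injective; toℕ<n; toℕ-fromℕ<; punchIn-punchOut; pigeonhole; splitAt-↑ˡ; splitAt-↑ʳ)
open import Data.List.Base using (List; []; _∷_; [_]; _++_; map; tabulate; allFin)
open import Data.List.Membership.Propositional using (_∈_; lose)
open import Data.List.Membership.Propositional.Properties
  using (∈-map⁺; ∈-++⁺ˡ; ∈-++⁺ʳ; ∈-tabulate⁺; ∈-allFin)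
open import Data.List.Relation.Unary.Any as Any using (Any; here; there)
open import Data.Nat.Base as ℕ using (ℕ; zero; suc; _+_; _*_; _<_; ≤′-refl; ≤′-step)
open import Data.Nat.Properties as ℕₚ
  using (even≢odd; *-cancelˡ-≡; suc-injective; <-cmp; m<1+n⇒m<n∨m≡n; n<1+n; ≤⇒≤′)
open import Data.Product using (Σ; ∃; ∃₂; _×_; _,_; proj₁; proj₂)
open import Data.Sum using (_⊎_; inj₁; inj₂; [_,_]′)
open import Function using (id; _∘_)
open import Function.Bundles using (Func; Injection; Inverse)
open import Level using (Level; _⊔_)
open import Relation.Binary.Definitions using (tri<; tri≈; tri>)
open import Relation.Binary.PropositionalEquality
  using (_≡_; _≢_; refl; sym; trans; cong; cong₂; subst; subst₂)
open import Relation.Nullary using (¬_; yes; no; contradiction)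
open import Relation.Nullary.Decidable using (decidable-stable)
open import Relation.Unary using (Pred)

private variable
  a b c p s r ℓ ℓ₁ ℓ₂ : Level
  A B C : Set a

-- Lattice terms

infixr 6 _∨_
infixr 7 _∧_

data Term (A : Set a) : Set a where
  var     : A → Term A
  _∨_ _∧_ : Term A → Term A → Term A

var-injective : {x y : A} → var x ≡ var y → x ≡ y
var-injective refl = refl

∨-injective : {t u t′ u′ : Term A} → t ∨ u ≡ t′ ∨ u′ → t ≡ t′ × u ≡ u′
∨-injective refl = refl , refl

∧-injective : {t u t′ u′ : Term A} → t ∧ u ≡ t′ ∧ u′ → t ≡ t′ × u ≡ u′
∧-injective refl = refl , refl

mapᵗ : (A → B) → Term A → Term B
mapᵗ f (var x) = var (f x)
mapᵗ f (t ∨ u) = mapᵗ f t ∨ mapᵗ f u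
mapᵗ f (t ∧ u) = mapᵗ f t ∧ mapᵗ f u

mapᵗ-∘ : (g : B → C) (f : A → B) → ∀ t → mapᵗ g (mapᵗ f t) ≡ mapᵗ (g ∘ f) t
mapᵗ-∘ g f (var x) = refl
mapᵗ-∘ g f (t ∨ u) = cong₂ _∨_ (mapᵗ-∘ g f t) (mapᵗ-∘ g f u)
mapᵗ-∘ g f (t ∧ u) = cong₂ _∧_ (mapᵗ-∘ g f t) (mapᵗ-∘ g f u)

mapᵗ-cong : {f g : A → B} → (∀ x → f x ≡ g x) → ∀ t → mapᵗ f t ≡ mapᵗ g t
mapᵗ-cong f≗g (var x) = cong var (f≗g x)
mapᵗ-cong f≗g (t ∨ u) = cong₂ _∨_ (mapᵗ-cong f≗g t) (mapᵗ-cong f≗g u)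
mapᵗ-cong f≗g (t ∧ u) = cong₂ _∧_ (mapᵗ-cong f≗g t) (mapᵗ-cong f≗g u)

mapᵗ-injective : {f : A → B} → (∀ {x y} → f x ≡ f y → x ≡ y) →
                 ∀ t u → mapᵗ f t ≡ mapᵗ f u → t ≡ u
mapᵗ-injective f-inj (var x) (var y)   eq = cong var (f-inj (var-injective eq))
mapᵗ-injective f-inj (t ∨ u) (t′ ∨ u′) eq with eqₜ , eqᵤ ← ∨-injective eq =
  cong₂ _∨_ (mapᵗ-injective f-inj t t′ eqₜ) (mapᵗ-injective f-inj u u′ eqᵤ)
mapᵗ-injective f-inj (t ∧ u) (t′ ∧ u′) eq with eqₜ , eqᵤ ← ∧-injective eq =
  cong₂ _∧_ (mapᵗ-injective f-inj t t′ eqₜ) (mapᵗ-injective f-inj u u′ eqᵤ)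

-- Every occurrence of a variable receives an index of its own. The shape `t` then ranges over a
-- countable set, whatever `A` is, and all of `A` that matters sits in the tuple.
skeleton : (w : Term A) → ∃ λ n → Σ (Term (Fin n)) λ t → Σ (Fin n → A) λ σ → mapᵗ σ t ≡ w
skeleton (var x) = 1 , var Fin.zero , (λ _ → x) , refl
skeleton (v ∨ w)
  with m , t , σ , refl ← skeleton v | n , u , τ , refl ← skeleton w =
  m + n , mapᵗ (_↑ˡ n) t ∨ mapᵗ (m ↑ʳ_) u , [ σ , τ ]′ ∘ Fin.splitAt m , cong₂ _∨_
    (trans (mapᵗ-∘ _ _ t) (mapᵗ-cong (λ i → cong [ σ , τ ]′ (splitAt-↑ˡ m i n)) t))
    (trans (mapᵗ-∘ _ _ u) (mapᵗ-cong (λ i → cong [ σ , τ ]′ (splitAt-↑ʳ m n i)) u))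
skeleton (v ∧ w)
  with m , t , σ , refl ← skeleton v | n , u , τ , refl ← skeleton w =
  m + n , mapᵗ (_↑ˡ n) t ∧ mapᵗ (m ↑ʳ_) u , [ σ , τ ]′ ∘ Fin.splitAt m , cong₂ _∧_
    (trans (mapᵗ-∘ _ _ t) (mapᵗ-cong (λ i → cong [ σ , τ ]′ (splitAt-↑ˡ m i n)) t))
    (trans (mapᵗ-∘ _ _ u) (mapᵗ-cong (λ i → cong [ σ , τ ]′ (splitAt-↑ʳ m n i)) u))

-- Countability

-- This is 2^m (2n + 1); parity separates the two clauses.
pair : ℕ → ℕ → ℕ
pair zero    n = suc (2 * n)
pair (suc m) n = 2 * pair m n

pair-injective : ∀ k m l n → pair k m ≡ pair l n → k ≡ l × m ≡ n
pair-injective zero    m zero    n eq = refl , *-cancelˡ-≡ m n 2 (suc-injective eq)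
pair-injective zero    m (suc l) n eq = contradiction (sym eq) (even≢odd (pair l n) m)
pair-injective (suc k) m zero    n eq = contradiction eq (even≢odd (pair k m) n)
pair-injective (suc k) m (suc l) n eq
  with refl , m≡n ← pair-injective k m l n (*-cancelˡ-≡ (pair k m) (pair l n) 2 eq) = refl , m≡n

encode : Term ℕ → ℕ
encode (var n) = pair 0 n
encode (t ∨ u) = pair 1 (pair (encode t) (encode u))
encode (t ∧ u) = pair 2 (pair (encode t) (encode u))

encode-injective : ∀ t u → encode t ≡ encode u → t ≡ u
encode-injective t u eq = go t u (pair-injective (tag t) (body t) (tag u) (body u)
  (trans (sym (split t)) (trans eq (split u))))
  where
  -- Comparing tags first makes the mixed constructor cases of `go` absurd by computation.
  tag body : Term ℕ → ℕ
  tag (var _) = 0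
  tag (_ ∨ _) = 1
  tag (_ ∧ _) = 2
  body (var n) = n
  body (t ∨ u) = pair (encode t) (encode u)
  body (t ∧ u) = pair (encode t) (encode u)

  split : ∀ t → encode t ≡ pair (tag t) (body t)
  split (var _) = refl
  split (_ ∨ _) = refl
  split (_ ∧ _) = refl

  go : ∀ t u → tag t ≡ tag u × body t ≡ body u → t ≡ u
  go (var m) (var n)   (_ , eq) = cong var eq
  go (t ∨ u) (t′ ∨ u′) (_ , eq)
    with eqₜ , eqᵤ ← pair-injective (encode t) (encode u) (encode t′) (encode u′) eq =
    cong₂ _∨_ (encode-injective t t′ eqₜ) (encode-injective u u′ eqᵤ)
  go (t ∧ u) (t′ ∧ u′) (_ , eq)
    with eqₜ , eqᵤ ← pair-injective (encode t) (encode u) (encode t′) (encode u′) eq =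
    cong₂ _∧_ (encode-injective t t′ eqₜ) (encode-injective u u′ eqᵤ)

module _ (X : Setoid c ℓ) where
  open Setoid X using (Carrier; _≈_)

  -- Codes are terms over ℕ, with _∨_ serving as the pairing.
  Encodable : Pred Carrier p → Set (c ⊔ ℓ ⊔ p)
  Encodable P = Σ (∀ {x} → P x → Term ℕ) λ code →
    ∀ {x y} (p : P x) (q : P y) → code p ≡ code q → x ≈ y

  module _ {I : Set a} (index : I → Term ℕ) (index-injective : ∀ {i j} → index i ≡ index j → i ≡ j)
           {P : I → Pred Carrier p} where

    ⋃-encodable : (∀ i → Encodable (P i)) → Encodable (λ x → ∃ λ i → P i x)
    ⋃-encodable enc = code , injective
      where
      code : ∀ {x} → (∃ λ i → P i x) → Term ℕ
      code (i , p) = index i ∨ proj₁ (enc i) p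

      injective : ∀ {x y} (p : ∃ λ i → P i x) (q : ∃ λ i → P i y) → code p ≡ code q → x ≈ y
      injective (i , p) (j , q) eq with ∨-injective eq
      ... | eqᵢ , eqₚ with refl ← index-injective eqᵢ = proj₂ (enc i) p q eqₚ

  module _ {I : Set a} {P : I → Pred Carrier p} (enc : ∀ i → Encodable (P i)) where

    -- The position in the list serves as the tag, so `I` itself may be uncountable. This matters
    -- below, where the indices include arbitrary generators.
    Any-encodable : ∀ is → Encodable (λ x → Any (λ i → P i x) is)
    Any-encodable [] = (λ ()) , λ ()
    Any-encodable (i ∷ is) = code , injective
      where
      code : ∀ {x} → Any (λ j → P j x) (i ∷ is) → Term ℕ
      code (here p)  = var 0 ∨ proj₁ (enc i) p
      code (there p) = var 1 ∨ proj₁ (Any-encodable is) p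

      injective : ∀ {x y} (p : Any (λ j → P j x) (i ∷ is)) (q : Any (λ j → P j y) (i ∷ is)) →
                  code p ≡ code q → x ≈ y
      injective (here p)  (here q)  eq = proj₂ (enc i) p q (proj₂ (∨-injective eq))
      injective (there p) (there q) eq = proj₂ (Any-encodable is) p q (proj₂ (∨-injective eq))

  Encodable-⊆ : {P : Pred Carrier p} {Q : Pred Carrier a} →
                (∀ {x} → P x → Q x) → Encodable Q → Encodable P
  Encodable-⊆ f (code , injective) = code ∘ f , λ p q → injective (f p) (f q)

module _ (em : Classical) where

  least : (P : Pred ℕ p) → ∃ P → ∃ λ n → P n × (∀ m → m < n → ¬ P m)
  least P (n , p) = [ id , (λ none → contradiction p (none n (n<1+n n))) ]′ (search (suc n))
    where
    search : ∀ n → (∃ λ k → P k × (∀ m → m < k → ¬ P m)) ⊎ (∀ m → m < n → ¬ P m)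
    search zero = inj₂ λ _ ()
    search (suc n) with search n
    ... | inj₁ found = inj₁ found
    ... | inj₂ none with em _ {P n}
    ...   | yes p = inj₁ (n , p , none)
    ...   | no ¬p = inj₂ λ m m<1+n q →
      [ (λ m<n → none m m<n q) , (λ { refl → ¬p q }) ]′ (m<1+n⇒m<n∨m≡n m<1+n)

  module _ (X : Setoid c ℓ) (f : Setoid.Carrier X → ℕ)
           (f-injective : ∀ {x y} → f x ≡ f y → Setoid._≈_ X x y) where
    private module X = Setoid X
    open X using (_≈_)

    private
      -- f need not respect _≈_; the least code of an equivalence class does.
      leastCode : ∀ x → ∃ λ n → (∃ λ y → y ≈ x × f y ≡ n) ×
                  (∀ m → m < n → ¬ ∃ λ y → y ≈ x × f y ≡ m)
      leastCode x = least _ (f x , x , X.refl , refl)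

      code : X.Carrier → ℕ
      code = proj₁ ∘ leastCode

      code-least : ∀ {x y} → x ≈ y → ¬ code x < code y
      code-least {x} {y} x≈y lt with z , z≈x , eq ← proj₁ (proj₂ (leastCode x)) =
        proj₂ (proj₂ (leastCode y)) (code x) lt (z , X.trans z≈x x≈y , eq)

      code-cong : ∀ {x y} → x ≈ y → code x ≡ code y
      code-cong {x} {y} x≈y with <-cmp (code x) (code y)
      ... | tri< lt _ _ = contradiction lt (code-least x≈y)
      ... | tri≈ _ eq _ = eq
      ... | tri> _ _ gt = contradiction gt (code-least (X.sym x≈y))

      code-injective : ∀ {x y} → code x ≡ code y → x ≈ y
      code-injective {x} {y} eq
        with u , u≈x , fu ← proj₁ (proj₂ (leastCode x))
           | v , v≈y , fv ← proj₁ (proj₂ (leastCode y)) =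
        X.trans (X.sym u≈x) (X.trans (f-injective (trans fu (trans eq (sym fv)))) v≈y)

      -- The number of values of `code` below the argument. Composing with it closes the gaps
      -- between codes, so that the values of `rank` form an initial segment of ℕ.
      count : ℕ → ℕ
      count zero = 0
      count (suc n) with em _ {∃ λ x → code x ≡ n}
      ... | yes _ = suc (count n)
      ... | no  _ = count n

      count-code : ∀ x → count (suc (code x)) ≡ suc (count (code x))
      count-code x with em _ {∃ λ y → code y ≡ code x}
      ... | yes _ = refl
      ... | no ¬p = contradiction (x , refl) ¬p

      count-step : ∀ n → count n ℕ.≤ count (suc n)
      count-step n with em _ {∃ λ x → code x ≡ n}
      ... | yes _ = ℕₚ.n≤1+n _
      ... | no  _ = ℕₚ.≤-refl

      count-mono : ∀ {m n} → m ℕ.≤′ n → count m ℕ.≤ count n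
      count-mono ≤′-refl       = ℕₚ.≤-refl
      count-mono (≤′-step m≤n) = ℕₚ.≤-trans (count-mono m≤n) (count-step _)

      rank : X.Carrier → ℕ
      rank = count ∘ code

      rank-< : ∀ {x y} → code x < code y → rank x < rank y
      rank-< {x} {y} lt = subst (ℕ._≤ rank y) (count-code x) (count-mono (≤⇒≤′ lt))

      rank-injective : ∀ {x y} → rank x ≡ rank y → x ≈ y
      rank-injective {x} {y} eq with <-cmp (code x) (code y)
      ... | tri< lt _ _ = contradiction eq (ℕₚ.<⇒≢ (rank-< lt))
      ... | tri≈ _ eq′ _ = code-injective eq′
      ... | tri> _ _ gt = contradiction (sym eq) (ℕₚ.<⇒≢ (rank-< gt))

      count-attained : ∀ n {k} → k < count n → ∃ λ x → rank x ≡ k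
      count-attained (suc n) k< with em _ {∃ λ x → code x ≡ n}
      ... | no _ = count-attained n k<
      ... | yes (x , eq) with m<1+n⇒m<n∨m≡n k<
      ...   | inj₁ k<n  = count-attained n k<n
      ...   | inj₂ refl = x , cong count eq

      rank-downward : ∀ x {k} → k ℕ.≤ rank x → ∃ λ y → rank y ≡ k
      rank-downward x {k} k≤ =
        count-attained (suc (code x)) (subst (k <_) (sym (count-code x)) (ℕ.s≤s k≤))

    -- The ranks are downward closed: they exhaust ℕ, or they are exactly the numbers below the
    -- least missing rank `N`.
    injection⇒countable : Countable X
    injection⇒countable with em _ {∀ n → ∃ λ x → rank x ≡ n}
    ... | yes onto = inj₂ record
      { to        = rank
      ; from      = proj₁ ∘ onto
      ; to-cong   = cong count ∘ code-cong
      ; from-cong = λ { refl → X.refl }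
      ; inverse   = (λ y≈ → trans (cong count (code-cong y≈)) (proj₂ (onto _)))
                  , (λ { refl → rank-injective (proj₂ (onto _)) })
      }
    ... | no ¬onto with em _ {∃ λ n → ¬ ∃ λ x → rank x ≡ n}
    ...   | no ¬gap = contradiction (λ n → decidable-stable (em _) λ ¬p → ¬gap (n , ¬p)) ¬onto
    ...   | yes gap with N , N∉ , below ← least _ gap = inj₁ (N , record
      { to        = λ x → fromℕ< (bound x)
      ; from      = λ i → proj₁ (hit i)
      ; to-cong   = to-cong
      ; from-cong = λ { refl → X.refl }
      ; inverse   = (λ {i} y≈ → trans (to-cong y≈) (toℕ-injective
                      (trans (toℕ-fromℕ< (bound _)) (proj₂ (hit i)))))
                  , (λ { refl → rank-injective (trans (proj₂ (hit _)) (toℕ-fromℕ< (bound _))) })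
      })
      where
      bound : ∀ x → rank x < N
      bound x = ℕₚ.≰⇒> λ N≤ → N∉ (rank-downward x N≤)

      hit : ∀ (i : Fin N) → ∃ λ x → rank x ≡ toℕ i
      hit i = decidable-stable (em _) (below (toℕ i) (toℕ<n i))

      to-cong : ∀ {x y} → x ≈ y → fromℕ< (bound x) ≡ fromℕ< (bound y)
      to-cong {x} {y} x≈y = toℕ-injective (trans (toℕ-fromℕ< (bound x))
        (trans (cong count (code-cong x≈y)) (sym (toℕ-fromℕ< (bound y)))))

-- Whitman's order on terms

module Whitman (S : Setoid s r) where
  private module S = Setoid S
  open S using () renaming (Carrier to ∣S∣; _≈_ to _≈ₛ_)

  infix 4 _≤_ _≈_

  -- Cut-free sequent rules. Since transitivity is not a rule, inverting a derivation of
  -- `t ∧ u ≤ v ∨ w` leaves only four last rules, which is Whitman's condition.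
  data _≤_ : Term ∣S∣ → Term ∣S∣ → Set (s ⊔ r) where
    var        : ∀ {x y} → x ≈ₛ y → var x ≤ var y
    ∨-least    : ∀ {t u v} → t ≤ v → u ≤ v → t ∨ u ≤ v
    ∧-greatest : ∀ {t u v} → t ≤ u → t ≤ v → t ≤ u ∧ v
    ∨-introˡ   : ∀ {t u v} → t ≤ u → t ≤ u ∨ v
    ∨-introʳ   : ∀ {t u v} → t ≤ v → t ≤ u ∨ v
    ∧-elimˡ    : ∀ {t u v} → t ≤ v → t ∧ u ≤ v
    ∧-elimʳ    : ∀ {t u v} → u ≤ v → t ∧ u ≤ v

  -- Cut elimination: the cut moves up past rules acting on the outer terms until both derivations
  -- act on the middle term. Each recursive call shrinks one derivation and enlarges neither.
  ≤-trans : ∀ {t u v} → t ≤ u → u ≤ v → t ≤ v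
  ≤-trans (∨-least p q)    r                = ∨-least (≤-trans p r) (≤-trans q r)
  ≤-trans (∧-elimˡ p)      r                = ∧-elimˡ (≤-trans p r)
  ≤-trans (∧-elimʳ p)      r                = ∧-elimʳ (≤-trans p r)
  ≤-trans p                (∧-greatest q r) = ∧-greatest (≤-trans p q) (≤-trans p r)
  ≤-trans p                (∨-introˡ q)     = ∨-introˡ (≤-trans p q)
  ≤-trans p                (∨-introʳ q)     = ∨-introʳ (≤-trans p q)
  ≤-trans (var p)          (var q)          = var (S.trans p q)
  ≤-trans (∧-greatest p q) (∧-elimˡ r)      = ≤-trans p r
  ≤-trans (∧-greatest p q) (∧-elimʳ r)      = ≤-trans q r
  ≤-trans (∨-introˡ p)     (∨-least q r)    = ≤-trans p q
  ≤-trans (∨-introʳ p)     (∨-least q r)    = ≤-trans p r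

  mapᵗ-cong-≤ : {f g : A → ∣S∣} → (∀ x → f x ≈ₛ g x) → ∀ t → mapᵗ f t ≤ mapᵗ g t
  mapᵗ-cong-≤ f≈g (var x) = var (f≈g x)
  mapᵗ-cong-≤ f≈g (t ∨ u) = ∨-least (∨-introˡ (mapᵗ-cong-≤ f≈g t)) (∨-introʳ (mapᵗ-cong-≤ f≈g u))
  mapᵗ-cong-≤ f≈g (t ∧ u) = ∧-greatest (∧-elimˡ (mapᵗ-cong-≤ f≈g t)) (∧-elimʳ (mapᵗ-cong-≤ f≈g u))

  ≤-refl : ∀ {t} → t ≤ t
  ≤-refl {var x} = var S.refl
  ≤-refl {t ∨ u} = ∨-least (∨-introˡ ≤-refl) (∨-introʳ ≤-refl)
  ≤-refl {t ∧ u} = ∧-greatest (∧-elimˡ ≤-refl) (∧-elimʳ ≤-refl)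

  mapᵗ-mono : (f : ∣S∣ → ∣S∣) → (∀ {x y} → x ≈ₛ y → f x ≈ₛ f y) →
              ∀ {t u} → t ≤ u → mapᵗ f t ≤ mapᵗ f u
  mapᵗ-mono f f-cong (var p)          = var (f-cong p)
  mapᵗ-mono f f-cong (∨-least p q)    = ∨-least (mapᵗ-mono f f-cong p) (mapᵗ-mono f f-cong q)
  mapᵗ-mono f f-cong (∧-greatest p q) = ∧-greatest (mapᵗ-mono f f-cong p) (mapᵗ-mono f f-cong q)
  mapᵗ-mono f f-cong (∨-introˡ p)     = ∨-introˡ (mapᵗ-mono f f-cong p)
  mapᵗ-mono f f-cong (∨-introʳ p)     = ∨-introʳ (mapᵗ-mono f f-cong p)
  mapᵗ-mono f f-cong (∧-elimˡ p)      = ∧-elimˡ (mapᵗ-mono f f-cong p)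
  mapᵗ-mono f f-cong (∧-elimʳ p)      = ∧-elimʳ (mapᵗ-mono f f-cong p)

  _≈_ : Term ∣S∣ → Term ∣S∣ → Set (s ⊔ r)
  t ≈ u = t ≤ u × u ≤ t

  ≈-sym : ∀ {t u} → t ≈ u → u ≈ t
  ≈-sym (p , q) = q , p

  ≈-trans : ∀ {t u v} → t ≈ u → u ≈ v → t ≈ v
  ≈-trans (p , p′) (q , q′) = ≤-trans p q , ≤-trans q′ p′

  ≈-reflexive : ∀ {t u} → t ≡ u → t ≈ u
  ≈-reflexive refl = ≤-refl , ≤-refl

  termLattice : Lattice s (s ⊔ r) (s ⊔ r)
  termLattice = record
    { Carrier   = Term ∣S∣
    ; _≈_       = _≈_
    ; _≤_       = _≤_
    ; _∨_       = _∨_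
    ; _∧_       = _∧_
    ; isLattice = record
      { isPartialOrder = record
        { isPreorder = record
          { isEquivalence = record
            { refl  = ≤-refl , ≤-refl
            ; sym   = ≈-sym
            ; trans = ≈-trans
            }
          ; reflexive = proj₁
          ; trans     = ≤-trans
          }
        ; antisym = _,_
        }
      ; supremum = λ t u → ∨-introˡ ≤-refl , ∨-introʳ ≤-refl , λ _ → ∨-least
      ; infimum  = λ t u → ∧-elimˡ ≤-refl , ∧-elimʳ ≤-refl , λ _ → ∧-greatest
      }
    }

  module _ (K : Lattice c ℓ₁ ℓ₂) (f : Func S (Lattice.setoid K)) where
    private module K = Lattice K

    eval : Term ∣S∣ → K.Carrier
    eval (var x) = Func.to f x
    eval (t ∨ u) = eval t K.∨ eval u
    eval (t ∧ u) = eval t K.∧ eval u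

    eval-mono : ∀ {t u} → t ≤ u → eval t K.≤ eval u
    eval-mono (var p)          = K.reflexive (Func.cong f p)
    eval-mono (∨-least p q)    = K.∨-least (eval-mono p) (eval-mono q)
    eval-mono (∧-greatest p q) = K.∧-greatest (eval-mono p) (eval-mono q)
    eval-mono (∨-introˡ p)     = K.trans (eval-mono p) (K.x≤x∨y _ _)
    eval-mono (∨-introʳ p)     = K.trans (eval-mono p) (K.y≤x∨y _ _)
    eval-mono (∧-elimˡ p)      = K.trans (K.x∧y≤x _ _) (eval-mono p)
    eval-mono (∧-elimʳ p)      = K.trans (K.x∧y≤y _ _) (eval-mono p)

    eval-cong : ∀ {t u} → t ≈ u → eval t K.≈ eval u
    eval-cong (p , q) = K.antisym (eval-mono p) (eval-mono q)

  infix 9 _⟪_⟫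

  -- `inj₁` marks a fixed generator and `inj₂` a slot to be filled by the tuple. Constants are
  -- allowed because eliminating a slot may put a generator in its place.
  _⟪_⟫ : ∀ {n} → Term (∣S∣ ⊎ Fin n) → (Fin n → ∣S∣) → Term ∣S∣
  t ⟪ σ ⟫ = mapᵗ [ id , σ ]′ t

  constants : Term (A ⊎ B) → List A
  constants (var (inj₁ x)) = [ x ]
  constants (var (inj₂ _)) = []
  constants (t ∨ u)        = constants t ++ constants u
  constants (t ∧ u)        = constants t ++ constants u

  -- A family of pairwise disjoint tuples is indiscernible: its members may be
  -- replaced by arbitrary tuples without destroying inequalities.
  module Indiscernible (em : Classical) {n} (σ : ℕ → Fin n → ∣S∣)
    (σ-injective : ∀ {k l i j} → σ k i ≈ₛ σ l j → k ≡ l × i ≡ j) where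

    Fresh : Term (∣S∣ ⊎ Fin n) → Set (s ⊔ r)
    Fresh t = ∀ {x} → x ∈ constants t → ∀ k i → ¬ x ≈ₛ σ k i

    module _ (ρ : ℕ → Fin n → ∣S∣) where

      -- Moves all tuples at once, which is consistent because their entries are distinct. Every
      -- other generator stays fixed, in particular the constants of a `Fresh` term.
      rename : ∣S∣ → ∣S∣
      rename x with em _ {∃₂ λ k i → x ≈ₛ σ k i}
      ... | yes (k , i , _) = ρ k i
      ... | no _            = x

      rename-σ : ∀ {x} k i → x ≈ₛ σ k i → rename x ≈ₛ ρ k i
      rename-σ {x} k i x≈ with em _ {∃₂ λ k i → x ≈ₛ σ k i}
      ... | no ¬p = contradiction (k , i , x≈) ¬p
      ... | yes (l , j , x≈′) with refl , refl ← σ-injective (S.trans (S.sym x≈) x≈′) = S.refl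

      rename-fresh : ∀ {x} → (∀ k i → ¬ x ≈ₛ σ k i) → rename x ≈ₛ x
      rename-fresh {x} x≉ with em _ {∃₂ λ k i → x ≈ₛ σ k i}
      ... | no _             = S.refl
      ... | yes (k , i , x≈) = contradiction x≈ (x≉ k i)

      rename-cong : ∀ {x y} → x ≈ₛ y → rename x ≈ₛ rename y
      rename-cong {x} {y} x≈y with em _ {∃₂ λ k i → x ≈ₛ σ k i}
      ... | yes (k , i , x≈) = S.sym (rename-σ k i (S.trans (S.sym x≈y) x≈))
      ... | no ¬p = S.trans x≈y (S.sym (rename-fresh λ k i y≈ → ¬p (k , i , S.trans x≈y y≈)))

      mapᵗ-rename : ∀ t → Fresh t → ∀ k → mapᵗ rename (t ⟪ σ k ⟫) ≈ t ⟪ ρ k ⟫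
      mapᵗ-rename (var (inj₁ x)) fresh k = var eq , var (S.sym eq)
        where eq = rename-fresh (fresh (here refl))
      mapᵗ-rename (var (inj₂ i)) fresh k = var eq , var (S.sym eq)
        where eq = rename-σ k i S.refl
      mapᵗ-rename (t ∨ u) fresh k
        with p , p′ ← mapᵗ-rename t (fresh ∘ ∈-++⁺ˡ) k
           | q , q′ ← mapᵗ-rename u (fresh ∘ ∈-++⁺ʳ (constants t)) k =
        ∨-least (∨-introˡ p) (∨-introʳ q) , ∨-least (∨-introˡ p′) (∨-introʳ q′)
      mapᵗ-rename (t ∧ u) fresh k
        with p , p′ ← mapᵗ-rename t (fresh ∘ ∈-++⁺ˡ) k
           | q , q′ ← mapᵗ-rename u (fresh ∘ ∈-++⁺ʳ (constants t)) k =
        ∧-greatest (∧-elimˡ p) (∧-elimʳ q) , ∧-greatest (∧-elimˡ p′) (∧-elimʳ q′)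

      replace : ∀ {t u} k l → Fresh t → Fresh u → t ⟪ σ k ⟫ ≤ u ⟪ σ l ⟫ → t ⟪ ρ k ⟫ ≤ u ⟪ ρ l ⟫
      replace {t} {u} k l ft fu p =
        ≤-trans (proj₂ (mapᵗ-rename t ft k))
          (≤-trans (mapᵗ-mono rename rename-cong p) (proj₁ (mapᵗ-rename u fu l)))

      replace-∨ : ∀ {t} j k l → Fresh t → t ⟪ σ j ⟫ ≤ t ⟪ σ k ⟫ ∨ t ⟪ σ l ⟫ →
                  t ⟪ ρ j ⟫ ≤ t ⟪ ρ k ⟫ ∨ t ⟪ ρ l ⟫
      replace-∨ {t} j k l ft p =
        ≤-trans (proj₂ (mapᵗ-rename t ft j)) (≤-trans (mapᵗ-mono rename rename-cong p)
          (∨-least (∨-introˡ (proj₁ (mapᵗ-rename t ft k))) (∨-introʳ (proj₁ (mapᵗ-rename t ft l)))))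

    module _ {t : Term (∣S∣ ⊎ Fin n)} (ft : Fresh t) where
      private
        w : ℕ → Term ∣S∣
        w k = t ⟪ σ k ⟫

        -- Isolates the tuple with index `k`: it becomes `α`, and all others become `β`.
        focus : ℕ → (α β : Fin n → ∣S∣) → ℕ → Fin n → ∣S∣
        focus k α β l with k ℕₚ.≟ l
        ... | yes _ = α
        ... | no  _ = β

        focus-≡ : ∀ k α β → focus k α β k ≡ α
        focus-≡ k α β with k ℕₚ.≟ k
        ... | yes _ = refl
        ... | no k≢k = contradiction refl k≢k

        focus-≢ : ∀ {k l} α β → k ≢ l → focus k α β l ≡ β
        focus-≢ {k} {l} α β k≢l with k ℕₚ.≟ l
        ... | yes k≡l = contradiction k≡l k≢l
        ... | no  _   = refl

        ≤-focus : ∀ {u} k {l} → k ≢ l → Fresh u → w k ≤ u ⟪ σ l ⟫ → ∀ α β → t ⟪ α ⟫ ≤ u ⟪ β ⟫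
        ≤-focus {u} k k≢l fu p α β =
          subst₂ (λ γ δ → t ⟪ γ ⟫ ≤ u ⟪ δ ⟫) (focus-≡ k α β) (focus-≢ α β k≢l)
            (replace (focus k α β) k _ ft fu p)

        -- Both joinands on the right turn into `t ⟪ β ⟫`, so their join lies below `t ⟪ β ⟫`.
        ≤∨-focus : ∀ j {k l} → j ≢ k → j ≢ l → w j ≤ w k ∨ w l → ∀ α β → t ⟪ α ⟫ ≤ t ⟪ β ⟫
        ≤∨-focus j {k} {l} j≢k j≢l p α β = ≤-trans
          (subst₂ (λ γ δ → t ⟪ γ ⟫ ≤ t ⟪ δ ⟫ ∨ t ⟪ focus j α β l ⟫) (focus-≡ j α β) (focus-≢ α β j≢k)
            (replace-∨ (focus j α β) j k l ft p))
          (∨-least ≤-refl (subst (λ γ → t ⟪ γ ⟫ ≤ t ⟪ β ⟫) (sym (focus-≢ α β j≢l)) ≤-refl))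

      -- Induction on `u`, which replaces `t` on the right because the right-hand rules descend into
      -- subterms. Once a left-hand rule is met, `w 1` or `w j` lies below an instance at `σ 0`, and
      -- both indices differ from 0.
      meet≤⇒collapse : ∀ u → Fresh u → ∀ {j} → j ≢ 0 →
        (w 0 ∨ w 1) ∧ (w 0 ∨ w j) ≤ u ⟪ σ 0 ⟫ → ∀ α β → t ⟪ α ⟫ ≤ u ⟪ β ⟫
      meet≤⇒collapse u fu {j} j≢0 = go u fu
        where
        left : ∀ {u} → Fresh u → w 0 ∨ w 1 ≤ u ⟪ σ 0 ⟫ → ∀ α β → t ⟪ α ⟫ ≤ u ⟪ β ⟫
        left {u} fu p = ≤-focus {u} 1 (λ ()) fu (≤-trans (∨-introʳ ≤-refl) p)

        right : ∀ {u} → Fresh u → w 0 ∨ w j ≤ u ⟪ σ 0 ⟫ → ∀ α β → t ⟪ α ⟫ ≤ u ⟪ β ⟫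
        right {u} fu p = ≤-focus {u} j j≢0 fu (≤-trans (∨-introʳ ≤-refl) p)

        go : ∀ u → Fresh u → (w 0 ∨ w 1) ∧ (w 0 ∨ w j) ≤ u ⟪ σ 0 ⟫ → ∀ α β → t ⟪ α ⟫ ≤ u ⟪ β ⟫
        go (var a) fu (∧-elimˡ p) = left {var a} fu p
        go (var a) fu (∧-elimʳ p) = right {var a} fu p
        go (u ∧ v) fu (∧-elimˡ p) = left {u ∧ v} fu p
        go (u ∧ v) fu (∧-elimʳ p) = right {u ∧ v} fu p
        go (u ∧ v) fu (∧-greatest p q) α β =
          ∧-greatest (go u (fu ∘ ∈-++⁺ˡ) p α β) (go v (fu ∘ ∈-++⁺ʳ (constants u)) q α β)
        go (u ∨ v) fu (∧-elimˡ p) = left {u ∨ v} fu p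
        go (u ∨ v) fu (∧-elimʳ p) = right {u ∨ v} fu p
        go (u ∨ v) fu (∨-introˡ p) α β = ∨-introˡ (go u (fu ∘ ∈-++⁺ˡ) p α β)
        go (u ∨ v) fu (∨-introʳ p) α β = ∨-introʳ (go v (fu ∘ ∈-++⁺ʳ (constants u)) p α β)

      -- The four cases of Whitman's condition. Each yields an inequality whose left index does not
      -- occur on the right, so the two sides can be renamed independently.
      meet≤join⇒collapse : ∀ {j k} → j ≢ 0 → k ≢ 0 → k ≢ 1 → j ≢ k →
        (w 0 ∨ w 1) ∧ (w 0 ∨ w j) ≤ w 0 ∨ w k → ∀ α β → t ⟪ α ⟫ ≤ t ⟪ β ⟫
      meet≤join⇒collapse j≢0 k≢0 k≢1 j≢k (∧-elimˡ p) =
        ≤∨-focus 1 (λ ()) (k≢1 ∘ sym) (≤-trans (∨-introʳ ≤-refl) p)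
      meet≤join⇒collapse j≢0 k≢0 k≢1 j≢k (∧-elimʳ p) =
        ≤∨-focus _ j≢0 j≢k (≤-trans (∨-introʳ ≤-refl) p)
      meet≤join⇒collapse j≢0 k≢0 k≢1 j≢k (∨-introˡ p) = meet≤⇒collapse t ft j≢0 p
      -- `w 0` lies below the meet, hence below `w k`.
      meet≤join⇒collapse j≢0 k≢0 k≢1 j≢k (∨-introʳ p) =
        ≤-focus {t} 0 (k≢0 ∘ sym) ft (≤-trans (∧-greatest (∨-introˡ ≤-refl) (∨-introˡ ≤-refl)) p)

-- Locally finite lattices embedded in the term lattice

module LocallyFiniteSublattice (em : Classical) (S : Setoid s r) (L : Lattice c ℓ₁ ℓ₂)
  (φ : Lattice.Carrier L → Term (Setoid.Carrier S))
  (φ-hom : IsLatticeHom L (Whitman.termLattice S) φ)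
  (φ-injective : ∀ {x y} → Whitman._≈_ S (φ x) (φ y) → Lattice._≈_ L x y)
  (locallyFinite : LocallyFinite (Lattice.poset L)) where

  open Whitman S
  private
    module S = Setoid S
    module L = Lattice L
    module φ = LatticeMorphisms.IsLatticeHomomorphism φ-hom
  open S using () renaming (Carrier to ∣S∣; _≈_ to _≈ₛ_)

  φ-mono : ∀ {x y} → x L.≤ y → φ x ≤ φ y
  φ-mono {x} {y} x≤y = ≤-trans (∨-introˡ ≤-refl) (≤-trans (proj₂ (φ.∨-homo x y))
    (proj₁ (φ.⟦⟧-cong (L.antisym (L.∨-least x≤y L.refl) (L.y≤x∨y x y)))))

  Instance : ∀ {n} → Term (∣S∣ ⊎ Fin n) → Pred L.Carrier (s ⊔ r)
  Instance {n} t x = Σ (Fin n → ∣S∣) λ σ → φ x ≈ t ⟪ σ ⟫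

  collapse⇒encodable : ∀ {n} (t : Term (∣S∣ ⊎ Fin n)) →
    (∀ σ τ → t ⟪ σ ⟫ ≤ t ⟪ τ ⟫) → Encodable L.setoid (Instance t)
  collapse⇒encodable t collapse =
    (λ _ → var 0) , λ (σ , p) (τ , q) _ → φ-injective (≈-trans p (≈-trans (collapse σ τ , collapse τ σ) (≈-sym q)))

  -- Substitutes `a`, a constant or one of the remaining slots, for slot `i` and renumbers the other
  -- slots.
  eliminate : ∀ {n} → Fin (suc n) → ∣S∣ ⊎ Fin n → ∣S∣ ⊎ Fin (suc n) → ∣S∣ ⊎ Fin n
  eliminate i a (inj₁ x) = inj₁ x
  eliminate i a (inj₂ j) with i Finₚ.≟ j
  ... | yes _  = a
  ... | no i≢j = inj₂ (punchOut i≢j)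

  -- The i-th entry of σ is the value of a at the remaining entries.
  _≈[_]_ : ∀ {n} → ∣S∣ ⊎ Fin n → Fin (suc n) → (Fin (suc n) → ∣S∣) → Set r
  a ≈[ i ] σ = [ id , σ ∘ punchIn i ]′ a ≈ₛ σ i

  eliminate-value : ∀ {n} (i : Fin (suc n)) a σ → a ≈[ i ] σ → ∀ v →
                    [ id , σ ]′ v ≈ₛ [ id , σ ∘ punchIn i ]′ (eliminate i a v)
  eliminate-value i a σ eq (inj₁ x) = S.refl
  eliminate-value i a σ eq (inj₂ j) with i Finₚ.≟ j
  ... | yes refl = S.sym eq
  ... | no i≢j   = S.reflexive (cong σ (sym (punchIn-punchOut i≢j)))

  eliminate-instance : ∀ {n} (t : Term (∣S∣ ⊎ Fin (suc n))) i a {x} ((σ , _) : Instance t x) →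
                       a ≈[ i ] σ → Instance (mapᵗ (eliminate i a) t) x
  eliminate-instance t i a (σ , p) eq = σ ∘ punchIn i , ≈-trans p
    (≈-trans (mapᵗ-cong-≤ (eliminate-value i a σ eq) t , mapᵗ-cong-≤ (S.sym ∘ eliminate-value i a σ eq) t)
      (≈-sym (≈-reflexive (mapᵗ-∘ _ _ t))))

  -- One list records both ways to lose a slot: an `inj₁` member says that an entry is a given
  -- generator, an `inj₂` member that it repeats another entry.
  Degenerate : ∀ {n} → List (∣S∣ ⊎ Fin n) → (Fin (suc n) → ∣S∣) → Set (s ⊔ r)
  Degenerate as σ = ∃ λ i → Any (_≈[ i ] σ) as

  -- Greedy choice of disjoint tuples

  module _ {n} (t : Term (∣S∣ ⊎ Fin (suc n)))
           (pick : ∀ as → ∃ λ x → Σ (Instance t x) λ (σ , _) → ¬ Degenerate as σ) where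

    private
      x⟨_⟩ : List (∣S∣ ⊎ Fin n) → L.Carrier
      x⟨ as ⟩ = proj₁ (pick as)

      σ⟨_⟩ : List (∣S∣ ⊎ Fin n) → Fin (suc n) → ∣S∣
      σ⟨ as ⟩ = proj₁ (proj₁ (proj₂ (pick as)))

      -- The initial list keeps tuples off the constants of `t` and, through all the `inj₂` members,
      -- free of repetitions. Each later list adds the entries of the tuple just chosen, which makes
      -- the tuples disjoint.
      avoided : ℕ → List (∣S∣ ⊎ Fin n)
      avoided zero    = map inj₁ (constants t) ++ map inj₂ (allFin n)
      avoided (suc k) = map inj₁ (tabulate σ⟨ avoided k ⟩) ++ avoided k

      σ : ℕ → Fin (suc n) → ∣S∣
      σ k = σ⟨ avoided k ⟩

      x : ℕ → L.Carrier
      x k = x⟨ avoided k ⟩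

      x-instance : ∀ k → φ (x k) ≈ t ⟪ σ k ⟫
      x-instance k = proj₂ (proj₁ (proj₂ (pick (avoided k))))

      avoided-mono : ∀ k {l a} → k ℕ.≤′ l → a ∈ avoided k → a ∈ avoided l
      avoided-mono k ≤′-refl           a∈ = a∈
      avoided-mono k (≤′-step {l} k≤l) a∈ = ∈-++⁺ʳ (map inj₁ (tabulate (σ l))) (avoided-mono k k≤l a∈)

      avoids : ∀ k i {a} → a ∈ avoided k → ¬ a ≈[ i ] σ k
      avoids k i a∈ eq = proj₂ (proj₂ (pick (avoided k))) (i , lose a∈ eq)

      avoids-initial : ∀ k i {a} → a ∈ avoided 0 → ¬ a ≈[ i ] σ k
      avoids-initial k i a∈ = avoids k i (avoided-mono 0 {k} (≤⇒≤′ ℕ.z≤n) a∈)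

      σ-disjoint : ∀ {k l i j} → k < l → ¬ σ k i ≈ₛ σ l j
      σ-disjoint {k} {l} {i} {j} k<l = avoids l j
        (avoided-mono (suc k) {l} (≤⇒≤′ k<l) (∈-++⁺ˡ (∈-map⁺ inj₁ (∈-tabulate⁺ {f = σ k} i))))

      σ-injective : ∀ {k l i j} → σ k i ≈ₛ σ l j → k ≡ l × i ≡ j
      σ-injective {k} {l} {i} {j} eq with <-cmp k l
      ... | tri< k<l _ _ = contradiction eq (σ-disjoint k<l)
      ... | tri> _ _ l<k = contradiction (S.sym eq) (σ-disjoint l<k)
      ... | tri≈ _ refl _ with i Finₚ.≟ j
      ...   | yes i≡j = refl , i≡j
      ...   | no i≢j  = contradiction
        (S.trans (S.reflexive (cong (σ k) (punchIn-punchOut i≢j))) (S.sym eq))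
        (avoids-initial k i (∈-++⁺ʳ (map inj₁ (constants t)) (∈-map⁺ inj₂ (∈-allFin (punchOut i≢j)))))

      open Indiscernible em σ σ-injective

      t-fresh : Fresh t
      t-fresh c∈ k i = avoids-initial k i (∈-++⁺ˡ (∈-map⁺ inj₁ c∈))

      join : ∀ k → φ (x 0) ∨ φ (x k) ≈ t ⟪ σ 0 ⟫ ∨ t ⟪ σ k ⟫
      join k = ∨-least (∨-introˡ (proj₁ (x-instance 0))) (∨-introʳ (proj₁ (x-instance k)))
             , ∨-least (∨-introˡ (proj₂ (x-instance 0))) (∨-introʳ (proj₂ (x-instance k)))

      φ-join : ∀ k → φ (x 0 L.∨ x k) ≈ t ⟪ σ 0 ⟫ ∨ t ⟪ σ k ⟫
      φ-join k = ≈-trans (φ.∨-homo (x 0) (x k)) (join k)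

      -- The shift by 2 keeps the varying index apart from 0 and 1, which the fixed join uses.
      point : ℕ → L.Carrier
      point k = (x 0 L.∨ x 1) L.∧ (x 0 L.∨ x (2 + k))

      points-coincide : ∃₂ λ j k → j ≢ k × point j L.≈ point k
      points-coincide with N , finite ← locallyFinite (x 0) (x 0 L.∨ x 1) (L.x≤x∨y _ _) =
        -- Among the first `N + 1` points, two must agree, since the interval has only `N` elements.
        let i , j , i<j , eq = pigeonhole (n<1+n N) (λ i → to (in-interval (toℕ i)))
        in toℕ i , toℕ j , ℕₚ.<⇒≢ i<j
         , L.Eq.trans (L.Eq.sym (strictlyInverseʳ (in-interval (toℕ i))))
             (L.Eq.trans (from-cong eq) (strictlyInverseʳ (in-interval (toℕ j))))
        where
        open Inverse finite using (to; from-cong; strictlyInverseʳ)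

        in-interval : ℕ → Setoid.Carrier (Interval L.poset (x 0) (x 0 L.∨ x 1))
        in-interval k = point k , L.∧-greatest (L.x≤x∨y _ _) (L.x≤x∨y _ _) , L.x∧y≤x _ _

      coincide⇒meet≤join : ∀ j k → point j L.≈ point k →
        (t ⟪ σ 0 ⟫ ∨ t ⟪ σ 1 ⟫) ∧ (t ⟪ σ 0 ⟫ ∨ t ⟪ σ (2 + j) ⟫) ≤ t ⟪ σ 0 ⟫ ∨ t ⟪ σ (2 + k) ⟫
      coincide⇒meet≤join j k eq =
        ≤-trans (∧-greatest (∧-elimˡ (proj₂ (φ-join 1))) (∧-elimʳ (proj₂ (φ-join (2 + j)))))
          (≤-trans (proj₂ (φ.∧-homo (x 0 L.∨ x 1) (x 0 L.∨ x (2 + j))))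
            (≤-trans (φ-mono (L.trans (L.reflexive eq) (L.x∧y≤y (x 0 L.∨ x 1) (x 0 L.∨ x (2 + k)))))
              (proj₁ (φ-join (2 + k)))))

    generic⇒collapse : ∀ α β → t ⟪ α ⟫ ≤ t ⟪ β ⟫
    generic⇒collapse = let j , k , j≢k , eq = points-coincide in
      meet≤join⇒collapse {t} t-fresh {2 + j} {2 + k} (λ ()) (λ ()) (λ ())
        (j≢k ∘ suc-injective ∘ suc-injective) (coincide⇒meet≤join j k eq)

  -- Induction on the number of slots. Either some finite list makes every instance degenerate, and
  -- a slot can be eliminated, or a nondegenerate instance exists for every list, and all instances
  -- coincide.
  instances-encodable : ∀ n (t : Term (∣S∣ ⊎ Fin n)) → Encodable L.setoid (Instance t)
  -- Without slots there is only the empty tuple.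
  instances-encodable zero t = collapse⇒encodable t λ _ _ →
    mapᵗ-cong-≤ (λ { (inj₁ _) → S.refl }) t
  instances-encodable (suc n) t
    with em _ {∃ λ as → ∀ x → ((σ , _) : Instance t x) → Degenerate as σ}
  ... | no generic = collapse⇒encodable t (generic⇒collapse t pick)
    where
    pick : ∀ as → ∃ λ x → Σ (Instance t x) λ (σ , _) → ¬ Degenerate as σ
    pick as = decidable-stable (em _) λ none →
      generic (as , λ x q → decidable-stable (em _) λ ¬d → none (x , q , ¬d))
  -- Each instance of `t` is an instance of one of finitely many terms with `n` slots, one for each
  -- position `i` and member `a` of `as`.
  ... | yes (as , degenerate) = Encodable-⊆ L.setoid
    (λ q → let i , d = degenerate _ q in i , Any.map (λ {a} → eliminate-instance t i a q) d)
    (⋃-encodable L.setoid (var ∘ toℕ) (toℕ-injective ∘ var-injective) λ i →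
      Any-encodable L.setoid (λ a → instances-encodable n (mapᵗ (eliminate i a) t)) as)

  countable : Countable L.setoid
  countable = injection⇒countable em L.setoid (λ x → encode (proj₁ encodable (instance-of x)))
    λ {x} {y} eq → proj₂ encodable (instance-of x) (instance-of y) (encode-injective _ _ eq)
    where
    -- The outer union runs over terms without constants, because only these are sure to be
    -- countable in number.
    encodable : Encodable L.setoid λ x → ∃ λ n → ∃ λ (t : Term (Fin n)) → Instance (mapᵗ inj₂ t) x
    encodable = ⋃-encodable L.setoid var var-injective λ n →
      ⋃-encodable L.setoid (mapᵗ toℕ) (mapᵗ-injective toℕ-injective _ _) λ t → instances-encodable n (mapᵗ inj₂ t)

    instance-of : ∀ x → ∃ λ n → ∃ λ (t : Term (Fin n)) → Instance (mapᵗ inj₂ t) x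
    instance-of x with n , t , σ , eq ← skeleton (φ x) =
      n , t , σ , ≈-reflexive (trans (sym eq) (sym (mapᵗ-∘ [ id , σ ]′ inj₂ t)))

-- Embedding the free lattice into the term lattice

module _ {S : Setoid s r} (FL : FreeLattice S c ℓ₁ ℓ₂) where
  open FreeLattice FL using (lattice; inclusion; universal)
  open Whitman S
  private
    module FL = Lattice lattice

    variables : Func S (Lattice.setoid termLattice)
    variables = record { to = var ; cong = λ p → var p , var (Setoid.sym S p) }

    generators : Func S FL.setoid
    generators = record { to = Injection.to inclusion ; cong = Injection.cong inclusion }

  toTerm : FL.Carrier → Term (Setoid.Carrier S)
  toTerm = proj₁ (universal termLattice variables)

  toTerm-hom : IsLatticeHom lattice termLattice toTerm
  toTerm-hom = proj₁ (proj₁ (proj₂ (universal termLattice variables)))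

  private
    module T = LatticeMorphisms.IsLatticeHomomorphism toTerm-hom

  -- Evaluation after `toTerm` and the identity are both homomorphisms extending the inclusion of
  -- generators, so each equals the unique extension `g`.
  eval-toTerm : ∀ x → eval lattice generators (toTerm x) FL.≈ x
  eval-toTerm x with g , _ , unique ← universal lattice generators =
    FL.Eq.trans (FL.Eq.sym (unique
      ( record
        { isRelHomomorphism = record { cong = eval-cong lattice generators ∘ T.⟦⟧-cong }
        ; ∧-homo = λ x y → eval-cong lattice generators (T.∧-homo x y)
        ; ∨-homo = λ x y → eval-cong lattice generators (T.∨-homo x y)
        }
      , λ s → eval-cong lattice generators (proj₂ (proj₁ (proj₂ (universal termLattice variables))) s))
      x))
      (unique
      ( record
        { isRelHomomorphism = record { cong = id }
        ; ∧-homo = λ _ _ → FL.Eq.refl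
        ; ∨-homo = λ _ _ → FL.Eq.refl
        }
      , λ _ → FL.Eq.refl)
      x)

  toTerm-injective : ∀ {x y} → toTerm x ≈ toTerm y → x FL.≈ y
  toTerm-injective eq = FL.Eq.trans (FL.Eq.sym (eval-toTerm _))
    (FL.Eq.trans (eval-cong lattice generators eq) (eval-toTerm _))

theorem3p4 : Classical →
    ∀ {s r c ℓ₁ ℓ₂ c′ ℓ₁′ ℓ₂′ p}
    (S : Setoid s r) (FL : FreeLattice S c ℓ₁ ℓ₂)
    (M : Sublattice (FreeLattice.lattice FL) p)
    (L : Lattice c′ ℓ₁′ ℓ₂′) →
    L ≅ Sublattice.lattice M →
    LocallyFinite (Lattice.poset L) →
    Countable (Lattice.setoid L)
theorem3p4 em S FL M L L≅M locallyFinite =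
  LocallyFiniteSublattice.countable em S L (toTerm FL ∘ proj₁ ∘ to) φ-hom φ-injective locallyFinite
  where
  open _≅_ L≅M
  module L = Lattice L
  module T = LatticeMorphisms.IsLatticeHomomorphism (toTerm-hom FL)
  module to = LatticeMorphisms.IsLatticeHomomorphism to-hom
  open Whitman S using (_≈_; ≈-trans; termLattice)

  φ-hom : IsLatticeHom L termLattice (toTerm FL ∘ proj₁ ∘ to)
  φ-hom = record
    { isRelHomomorphism = record { cong = T.⟦⟧-cong ∘ to.⟦⟧-cong }
    ; ∧-homo = λ x y → ≈-trans (T.⟦⟧-cong (to.∧-homo x y)) (T.∧-homo _ _)
    ; ∨-homo = λ x y → ≈-trans (T.⟦⟧-cong (to.∨-homo x y)) (T.∨-homo _ _)
    }

  φ-injective : ∀ {x y} → toTerm FL (proj₁ (to x)) ≈ toTerm FL (proj₁ (to y)) → x L.≈ y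
  φ-injective {x} eq = L.Eq.trans
    -- Both `x` and `y` equal `from (to x)`, as equality in the sublattice is that of the free
    -- lattice.
    (L.Eq.sym (proj₂ inverse {x} {to x} (Lattice.Eq.refl (FreeLattice.lattice FL))))
    (proj₂ inverse (toTerm-injective FL eq))
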